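{- For $1\le i\le k$ let $G_i$ be an $r_i$-regular graph with $n_i$ vertices that admits a balanced labelling. Suppose $r_i\le n_j$ for all $1\le i,j\le k$, and that $r=\sum_{i=1}^k r_i$ is coprime to $n_1n_2\cdots n_k$. Then $G_1\Box\cdots\Box G_k$ is $\mathbb{Z}_{n_1\cdots n_k}$-distance antimagic.
   Context: For an $r$-regular graph $G$ with $n$ vertices, a balanced labelling is a bijection $f:V(G)\to\mathbb{Z}_n$ such that $\sum_{y\in N(x)} f(y)\equiv r f(x)\pmod n$ for every vertex $x$ ($N(x)$ the open neighbourhood). The Cartesian product $G_1\Box\cdots\Box G_k$ has vertex set $V(G_1)\times\cdots\times V(G_k)$, with two tuples adjacent iff they differ in exactly one coordinate $i$ and are adjacent there in $G_i$. For a graph $G$ with $n$ vertices, a $\mathbb{Z}_n$-distance antimagic labelling is a bijection $f:V(G)\to\mathbb{Z}_n$ such that the weights $w_f(x)=\sum_{y\in N(x)} f(y)$ (mod $n$) are pairwise distinct; $G$ is $\mathbb{Z}_n$-distance antimagic if such a labelling exists. -}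

module Defs where

open import Algebra.Properties.CommutativeMonoid.Sum as Sum using ()
open import Data.Fin.Base using (Fin; zero; suc; toℕ)
open import Data.Fin.Properties using (_≟_; *↔×; 1↔⊤; any?; all?)
open import Data.List.Base using (List; allFin; filter; length; map; sum)
open import Data.Nat.Base using (ℕ; zero; suc; _*_; ∣_-_∣)
open import Data.Nat.Divisibility using (_∣_)
open import Data.Nat.Properties using (+-0-commutativeMonoid; *-1-commutativeMonoid)
open import Data.Product.Base using (_×_; _,_; ∃)
open import Data.Product.Function.NonDependent.Propositional using (_×-↔_)
open import Data.Unit.Base using (⊤)
open import Function.Base using (_∘_)
open import Function.Bundles using (_↔_; _⤖_; Inverse; Bijection)
open import Function.Construct.Composition using (_↔-∘_)
open import Function.Properties.Inverse using (↔-sym; ↔⇒↣)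
open import Relation.Binary.Definitions using (Decidable; DecidableEquality; Symmetric)
open import Relation.Binary.PropositionalEquality.Core using (_≡_; _≢_; sym)
open import Relation.Nullary.Decidable using (¬?; _×-dec_; _→-dec_; via-injection)
open import Relation.Nullary.Negation using (¬_)

∑ : ∀ {k} → (Fin k → ℕ) → ℕ
∑ = Sum.sum +-0-commutativeMonoid

∏ : ∀ {k} → (Fin k → ℕ) → ℕ
∏ = Sum.sum *-1-commutativeMonoid

infix 4 _≡_[mod_]
_≡_[mod_] : ℕ → ℕ → ℕ → Set
a ≡ b [mod n ] = n ∣ ∣ a - b ∣

-- Finite simple graphs.  The enumeration serves only to sum and count over
-- vertices; neither result depends on which enumeration is chosen.
record Graph : Set₁ where
  field
    V      : Set
    order  : ℕ
    enum   : Fin order ↔ V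
    Adj    : V → V → Set
    adj?   : Decidable Adj
    symm   : Symmetric Adj
    irrefl : ∀ {x} → ¬ Adj x x

  infix 4 _≟ⱽ_
  _≟ⱽ_ : DecidableEquality V
  _≟ⱽ_ = via-injection (↔⇒↣ (↔-sym enum)) _≟_

  vertices : List V
  vertices = map (Inverse.to enum) (allFin order)

  N : V → List V
  N x = filter (adj? x) vertices

open Graph using (order)

IsRegular : Graph → ℕ → Set
IsRegular G r = ∀ x → length (N x) ≡ r
  where open Graph G

-- Residues mod n are represented by Fin n, i.e. by their least non-negative
-- representatives; sums of labels are formed in ℕ and compared mod n.
Labelling : Graph → Set
Labelling G = Graph.V G ⤖ Fin (order G)

label : (G : Graph) → Labelling G → Graph.V G → ℕ
label G f x = toℕ (Bijection.to f x)

weight : (G : Graph) → Labelling G → Graph.V G → ℕ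
weight G f x = sum (map (label G f) (Graph.N G x))

-- Meaningful for r-regular G.
IsBalanced : (G : Graph) → ℕ → Labelling G → Set
IsBalanced G r f = ∀ x → weight G f x ≡ r * label G f x [mod order G ]

IsDistanceAntimagicLabelling : (G : Graph) → Labelling G → Set
IsDistanceAntimagicLabelling G f =
  ∀ x y → x ≢ y → ¬ (weight G f x ≡ weight G f y [mod order G ])

-- ℤₙ-distance antimagic, where n is the order of G.
DistanceAntimagic : Graph → Set
DistanceAntimagic G = ∃ (IsDistanceAntimagicLabelling G)

-- A₀ × ⋯ × Aₖ₋₁ as nested pairs: without function extensionality the function
-- type (i : Fin k) → A i does not have the right propositional equality.
Tuple : ∀ {k} → (Fin k → Set) → Set
Tuple {zero}  A = ⊤
Tuple {suc k} A = A zero × Tuple (A ∘ suc)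

coord : ∀ {k} {A : Fin k → Set} → Tuple A → ∀ i → A i
coord {suc k} (a , _) zero    = a
coord {suc k} (_ , t) (suc i) = coord t i

enumTuple : ∀ {k} {A : Fin k → Set} {n : Fin k → ℕ} →
            (∀ i → Fin (n i) ↔ A i) → Fin (∏ n) ↔ Tuple A
enumTuple {zero}          e = 1↔⊤
enumTuple {suc k} {n = n} e =
  (e zero ×-↔ enumTuple (e ∘ suc)) ↔-∘ *↔× {n zero} {∏ (n ∘ suc)}

module _ {k} (G : Fin k → Graph) where
  private module G i = Graph (G i)

  -- Since each Gᵢ is irreflexive, x and y do differ at the coordinate i.
  □-Adj : Tuple G.V → Tuple G.V → Set
  □-Adj x y = ∃ λ i → G.Adj i (coord x i) (coord y i) ×
                      (∀ j → j ≢ i → coord x j ≡ coord y j)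

  □ : Graph
  □ = record
    { V      = Tuple G.V
    ; order  = ∏ G.order
    ; enum   = enumTuple G.enum
    ; Adj    = □-Adj
    ; adj?   = λ x y → any? λ i →
                 G.adj? i (coord x i) (coord y i) ×-dec
                 all? λ j → ¬? (j ≟ i) →-dec G._≟ⱽ_ j (coord x j) (coord y j)
    ; symm   = λ (i , a , eq) → i , G.symm i a , λ j j≢i → sym (eq j j≢i)
    ; irrefl = λ (i , a , _) → G.irrefl i a
    }

{-# OPTIONS --safe #-}
-- Number the vertices of the product in mixed radix, with the balanced
-- labels fᵢ(xᵢ) as digits.  Write x = (a , t), let n′ be the order of the
-- product of the remaining factors and f′, w′ its labelling and weight, so that
-- f(a , t) = n′ f₀(a) + f′(t).  Balancedness gives
--   w(a , t) ≡ n′ (r₀ + r₁ + ⋯) f₀(a) + r₀ f′(t) + w′(t)  (mod n₀ n′).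
-- Modulo n′ only r₀ f′(t) + w′(t) survives, so induction recovers t, provided
-- that the claim is generalised to injectivity of c f + w whenever c + Σ rᵢ is
-- coprime to the order.  Once t is known, (c + Σ rᵢ) f₀(a) is determined mod n₀,
-- and hence so is a.
module Submission where

open import Defs
open import Data.Fin.Base using (Fin; zero; suc; toℕ)
open import Data.Fin.Properties using (toℕ<n; toℕ-injective; toℕ-combine; nonZeroIndex)
import Data.Fin.Properties as Fin
open import Data.List.Base using (List; []; _∷_; _++_; map; length)
open import Data.List.Membership.Propositional using (_∈_)
open import Data.List.Membership.Propositional.Properties
  using (∈-map⁺; ∈-map⁻; ∈-++⁺ˡ; ∈-++⁺ʳ; ∈-++⁻; ∈-filter⁺; ∈-filter⁻; ∈-allFin)
open import Data.List.Membership.Propositional.Properties.WithK using (unique∧set⇒bag)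
open import Data.List.Properties using (map-++; map-cong; map-∘; length-++; length-map)
open import Data.List.Relation.Binary.BagAndSetEquality using (∼bag⇒↭)
open import Data.List.Relation.Binary.Permutation.Propositional using (_↭_)
open import Data.List.Relation.Binary.Permutation.Propositional.Properties using (map⁺; ↭-length)
open import Data.List.Relation.Unary.Unique.Propositional using (Unique)
import Data.List.Relation.Unary.Unique.Propositional.Properties as Unique
open import Data.Nat.Base
  using (ℕ; zero; suc; _+_; _*_; _≤_; _<_; _∸_; ∣_-_∣; NonZero)
open import Data.Nat.Coprimality using (Coprime; coprime-divisor)
import Data.Nat.Coprimality as Coprimality
open import Data.Nat.Divisibility
open import Data.Nat.ListAction using (sum)
open import Data.Nat.ListAction.Properties using (sum-++; sum-↭)
open import Data.Nat.Properties
open import Data.Nat.Tactic.RingSolver using (solve-∀)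
open import Data.Product.Base using (∃; _×_; _,_; proj₁; proj₂)
open import Data.Product.Properties using (,-injectiveˡ; ,-injectiveʳ)
open import Data.Sum.Base using (_⊎_; inj₁; inj₂)
open import Data.Unit.Base using (tt)
open import Function.Base using (_∘_)
open import Function.Bundles using (mk⇔; Injection; Inverse; Bijection)
open import Function.Properties.Bijection using (⤖⇒↔)
open import Function.Properties.Inverse using (↔-sym; ↔⇒⤖; ↔⇒↣)
open import Relation.Binary.PropositionalEquality
open import Relation.Nullary.Negation using (contradiction)

-- Congruences between natural numbers

-- Subtraction-free congruence, for which transitivity is a semiring identity.
mod⇒witness : ∀ {n a b} → a ≡ b [mod n ] → ∃ λ p → ∃ λ q → a + p * n ≡ b + q * n
mod⇒witness {n} {a} {b} (divides q eq) with ≤-total a b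
... | inj₁ a≤b = q , 0 , (begin
  a + q * n       ≡⟨ cong (a +_) eq ⟨
  a + ∣ a - b ∣   ≡⟨ cong (a +_) (m≤n⇒∣m-n∣≡n∸m a≤b) ⟩
  a + (b ∸ a)     ≡⟨ m+[n∸m]≡n a≤b ⟩
  b               ≡⟨ +-identityʳ b ⟨
  b + 0           ∎)
  where open ≡-Reasoning
... | inj₂ b≤a = 0 , q , (begin
  a + 0           ≡⟨ +-identityʳ a ⟩
  a               ≡⟨ m+[n∸m]≡n b≤a ⟨
  b + (a ∸ b)     ≡⟨ cong (b +_) (m≤n⇒∣n-m∣≡n∸m b≤a) ⟨
  b + ∣ a - b ∣   ≡⟨ cong (b +_) eq ⟩
  b + q * n       ∎)
  where open ≡-Reasoning

witness⇒mod : ∀ {n a b} p q → a + p * n ≡ b + q * n → a ≡ b [mod n ]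
witness⇒mod {n} {a} {b} p q eq = divides ∣ q - p ∣ (begin
  ∣ a - b ∣                       ≡⟨ ∣m+n-m+o∣≡∣n-o∣ (p * n) a b ⟨
  ∣ p * n + a - p * n + b ∣       ≡⟨ cong₂ ∣_-_∣ (+-comm (p * n) a) (+-comm (p * n) b) ⟩
  ∣ a + p * n - b + p * n ∣       ≡⟨ cong (∣_- b + p * n ∣) eq ⟩
  ∣ b + q * n - b + p * n ∣       ≡⟨ ∣m+n-m+o∣≡∣n-o∣ b (q * n) (p * n) ⟩
  ∣ q * n - p * n ∣               ≡⟨ *-distribʳ-∣-∣ n q p ⟨
  ∣ q - p ∣ * n                   ∎)
  where open ≡-Reasoning

mod-sym : ∀ {n} a b → a ≡ b [mod n ] → b ≡ a [mod n ]
mod-sym a b = subst (_ ∣_) (∣-∣-comm a b)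

mod-trans : ∀ {n} a b c → a ≡ b [mod n ] → b ≡ c [mod n ] → a ≡ c [mod n ]
mod-trans {n} a b c a≡b b≡c
  with p , q , eq ← mod⇒witness {n} {a} {b} a≡b
     | p′ , q′ , eq′ ← mod⇒witness {n} {b} {c} b≡c
  = witness⇒mod (p + p′) (q′ + q) (begin
  a + (p + p′) * n        ≡⟨ assocʳ a p p′ n ⟩
  (a + p * n) + p′ * n    ≡⟨ cong (_+ p′ * n) eq ⟩
  (b + q * n) + p′ * n    ≡⟨ exchange b q p′ n ⟩
  (b + p′ * n) + q * n    ≡⟨ cong (_+ q * n) eq′ ⟩
  (c + q′ * n) + q * n    ≡⟨ assocʳ c q′ q n ⟨
  c + (q′ + q) * n        ∎)
  where
  open ≡-Reasoning
  assocʳ : ∀ x y z n → x + (y + z) * n ≡ (x + y * n) + z * n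
  assocʳ = solve-∀
  exchange : ∀ x y z n → (x + y * n) + z * n ≡ (x + z * n) + y * n
  exchange = solve-∀

mod-conv : ∀ {n} a a′ b b′ → a ≡ a′ [mod n ] → b ≡ b′ [mod n ] →
           a ≡ b [mod n ] → a′ ≡ b′ [mod n ]
mod-conv a a′ b b′ a≡a′ b≡b′ a≡b =
  mod-trans a′ a b′ (mod-sym a a′ a≡a′) (mod-trans a b b′ a≡b b≡b′)

n*m+a≡a : ∀ n m a → n * m + a ≡ a [mod n ]
n*m+a≡a n m a = witness⇒mod 0 m (shuffle n m a)
  where
  shuffle : ∀ n m a → n * m + a + 0 * n ≡ a + m * n
  shuffle = solve-∀

mod-+-cancelʳ : ∀ {n} c a b → a + c ≡ b + c [mod n ] → a ≡ b [mod n ]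
mod-+-cancelʳ {n} c a b = subst (n ∣_) (begin
  ∣ a + c - b + c ∣ ≡⟨ cong₂ ∣_-_∣ (+-comm a c) (+-comm b c) ⟩
  ∣ c + a - c + b ∣ ≡⟨ ∣m+n-m+o∣≡∣n-o∣ c a b ⟩
  ∣ a - b ∣         ∎)
  where open ≡-Reasoning

-- Since `m` is also a factor of the modulus, cancelling it shrinks the modulus to `n`.
mod-*-cancelˡ : ∀ {n} m .{{_ : NonZero m}} a b → m * a ≡ m * b [mod m * n ] → a ≡ b [mod n ]
mod-*-cancelˡ {n} m a b eq =
  *-cancelˡ-∣ m (subst (m * n ∣_) (sym (*-distribˡ-∣-∣ m a b)) eq)

mod-coprime-cancelˡ : ∀ {n} r a b → Coprime r n → r * a ≡ r * b [mod n ] → a ≡ b [mod n ]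
mod-coprime-cancelˡ {n} r a b c eq =
  coprime-divisor (Coprimality.sym c) (subst (n ∣_) (sym (*-distribˡ-∣-∣ r a b)) eq)

∣∧<⇒≡0 : ∀ {n m} → n ∣ m → m < n → m ≡ 0
∣∧<⇒≡0 {m = zero}  _   _   = refl
∣∧<⇒≡0 {m = suc m} n∣m m<n = contradiction n∣m (>⇒∤ m<n)

-- Two least residues are at distance less than `n`, and the only multiple of `n` that small is 0.
mod-toℕ-injective : ∀ {n} (i j : Fin n) → toℕ i ≡ toℕ j [mod n ] → i ≡ j
mod-toℕ-injective i j eq = toℕ-injective (∣m-n∣≡0⇒m≡n (∣∧<⇒≡0 eq
  (≤-<-trans (∣m-n∣≤m⊔n (toℕ i) (toℕ j)) (⊔-lub (toℕ<n i) (toℕ<n j)))))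

-- Sums over lists

-- Used for neighbours that differ in a later coordinate: they share the leading digit, which
-- contributes the constant `d`.
sum-map-const+ : ∀ {A : Set} (h : A → ℕ) d (xs : List A) →
                 sum (map (λ x → d + h x) xs) ≡ length xs * d + sum (map h xs)
sum-map-const+ h d []       = refl
sum-map-const+ h d (x ∷ xs) rewrite sum-map-const+ h d xs =
  regroup d (h x) (length xs * d) (sum (map h xs))
  where
  regroup : ∀ d a b c → d + a + (b + c) ≡ d + b + (a + c)
  regroup = solve-∀

-- Used for neighbours that differ in the first coordinate: the leading digit varies with place
-- value `c`, and the lower digits contribute the constant `d`.
sum-map-*+const : ∀ {A : Set} c (h : A → ℕ) d (xs : List A) →
                  sum (map (λ x → c * h x + d) xs) ≡ c * sum (map h xs) + length xs * d
sum-map-*+const c h d []       = regroup c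
  where
  regroup : ∀ c → 0 ≡ c * 0 + 0
  regroup = solve-∀
sum-map-*+const c h d (x ∷ xs) rewrite sum-map-*+const c h d xs =
  regroup c (h x) d (sum (map h xs)) (length xs * d)
  where
  regroup : ∀ c a d s l → c * a + d + (c * s + l) ≡ c * (a + s) + (d + l)
  regroup = solve-∀

-- Neighbourhoods

module _ (G : Graph) where
  open Graph G

  N-unique : ∀ x → Unique (N x)
  N-unique x = Unique.filter⁺ (adj? x)
    (Unique.map⁺ (Injection.injective (↔⇒↣ enum)) (Unique.allFin⁺ order))

  ∈-N⁺ : ∀ {x y} → Adj x y → y ∈ N x
  ∈-N⁺ {x} {y} xy = ∈-filter⁺ (adj? x) y∈vertices xy
    where
    y∈vertices : y ∈ vertices
    y∈vertices = subst (_∈ vertices) (Inverse.strictlyInverseˡ enum y)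
      (∈-map⁺ (Inverse.to enum) (∈-allFin (Inverse.from enum y)))

  ∈-N⁻ : ∀ {x y} → y ∈ N x → Adj x y
  ∈-N⁻ {x} y∈ = proj₂ (∈-filter⁻ (adj? x) {xs = vertices} y∈)

-- Splitting the first factor off a Cartesian product

coord-ext : ∀ {k} {A : Fin k → Set} (s t : Tuple A) →
            (∀ i → coord s i ≡ coord t i) → s ≡ t
coord-ext {zero}  _       _       _  = refl
coord-ext {suc k} (a , s) (b , t) eq = cong₂ _,_ (eq zero) (coord-ext s t (eq ∘ suc))

module _ {k} (G : Fin (suc k) → Graph) where
  private
    module G₀ = Graph (G zero)
    module G′ = Graph (□ (G ∘ suc))
    module G□ = Graph (□ G)

  □-Adj⁺ˡ : ∀ {a b t} → G₀.Adj a b → G□.Adj (a , t) (b , t)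
  □-Adj⁺ˡ ab = zero , ab , λ where
    zero    0≢0 → contradiction refl 0≢0
    (suc j) _   → refl

  □-Adj⁺ʳ : ∀ {a s t} → G′.Adj s t → G□.Adj (a , s) (a , t)
  □-Adj⁺ʳ (i , st , eq) = suc i , st , λ where
    zero    _   → refl
    (suc j) j≢i → eq j (j≢i ∘ cong suc)

  □-Adj⁻ : ∀ {a b s t} → G□.Adj (a , s) (b , t) →
           (G₀.Adj a b × s ≡ t) ⊎ (a ≡ b × G′.Adj s t)
  □-Adj⁻ {s = s} {t} (zero  , ab , eq) = inj₁ (ab , coord-ext s t (λ i → eq (suc i) λ ()))
  □-Adj⁻             (suc i , st , eq) =
    inj₂ (eq zero (λ ()) , i , st , λ j j≢i → eq (suc j) (j≢i ∘ Fin.suc-injective))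

  -- Both lists are free of duplicates, so equality of their sets of members already makes them
  -- permutations of each other; their orders may differ.
  N-□ : ∀ a t → G□.N (a , t) ↭ map (_, t) (G₀.N a) ++ map (a ,_) (G′.N t)
  N-□ a t = ∼bag⇒↭ (unique∧set⇒bag (N-unique (□ G) (a , t)) unique (mk⇔ to from))
    where
    unique : Unique (map (_, t) (G₀.N a) ++ map (a ,_) (G′.N t))
    unique = Unique.++⁺
      (Unique.map⁺ ,-injectiveˡ (N-unique (G zero) a))
      (Unique.map⁺ ,-injectiveʳ (N-unique (□ (G ∘ suc)) t))
      λ (p , q) → disjoint (∈-map⁻ (_, t) p) (∈-map⁻ (a ,_) q)
      where
      disjoint : ∀ {v} → (∃ λ b → b ∈ G₀.N a × v ≡ (b , t)) →
                 (∃ λ s → s ∈ G′.N t × v ≡ (a , s)) → _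
      -- A common member is both `(b , t)` and `(a , s)`, so `b` is `a` and `a` would be its own
      -- neighbour.
      disjoint (b , b∈ , refl) (s , s∈ , refl) = G₀.irrefl (∈-N⁻ (G zero) b∈)

    to : ∀ {v} → v ∈ G□.N (a , t) → v ∈ map (_, t) (G₀.N a) ++ map (a ,_) (G′.N t)
    to {b , s} v∈ with □-Adj⁻ (∈-N⁻ (□ G) v∈)
    ... | inj₁ (ab , refl) = ∈-++⁺ˡ (∈-map⁺ (_, t) (∈-N⁺ (G zero) ab))
    ... | inj₂ (refl , ts) =
      ∈-++⁺ʳ (map (_, t) (G₀.N a)) (∈-map⁺ (a ,_) (∈-N⁺ (□ (G ∘ suc)) ts))

    from : ∀ {v} → v ∈ map (_, t) (G₀.N a) ++ map (a ,_) (G′.N t) → v ∈ G□.N (a , t)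
    from v∈ with ∈-++⁻ (map (_, t) (G₀.N a)) v∈
    ... | inj₁ p with b , b∈ , refl ← ∈-map⁻ (_, t) p =
      ∈-N⁺ (□ G) (□-Adj⁺ˡ (∈-N⁻ (G zero) b∈))
    ... | inj₂ q with s , s∈ , refl ← ∈-map⁻ (a ,_) q =
      ∈-N⁺ (□ G) (□-Adj⁺ʳ (∈-N⁻ (□ (G ∘ suc)) s∈))

  sum-N-□ : ∀ (g : G□.V → ℕ) a t →
            sum (map g (G□.N (a , t))) ≡
            sum (map (λ b → g (b , t)) (G₀.N a)) + sum (map (λ s → g (a , s)) (G′.N t))
  sum-N-□ g a t = begin
    sum (map g (G□.N (a , t)))                   ≡⟨ sum-↭ (map⁺ g (N-□ a t)) ⟩
    sum (map g (L₁ ++ L₂))                       ≡⟨ cong sum (map-++ g L₁ L₂) ⟩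
    sum (map g L₁ ++ map g L₂)                   ≡⟨ sum-++ (map g L₁) (map g L₂) ⟩
    sum (map g L₁) + sum (map g L₂)              ≡⟨ cong₂ (λ xs ys → sum xs + sum ys)
                                                           (map-∘ (G₀.N a)) (map-∘ (G′.N t)) ⟨
    sum (map (λ b → g (b , t)) (G₀.N a)) + sum (map (λ s → g (a , s)) (G′.N t)) ∎
    where
    open ≡-Reasoning
    L₁ L₂ : List G□.V
    L₁ = map (_, t) (G₀.N a)
    L₂ = map (a ,_) (G′.N t)

□-regular : ∀ {k} (G : Fin k → Graph) (r : Fin k → ℕ) →
            (∀ i → IsRegular (G i) (r i)) → IsRegular (□ G) (∑ r)
□-regular {zero}  G r reg tt      = refl
□-regular {suc k} G r reg (a , t) = begin
  length (Graph.N (□ G) (a , t))              ≡⟨ ↭-length (N-□ G a t) ⟩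
  length (map (_, t) Na ++ map (a ,_) Nt)     ≡⟨ length-++ (map (_, t) Na) ⟩
  length (map (_, t) Na) + length (map (a ,_) Nt)
    ≡⟨ cong₂ _+_ (length-map (_, t) Na) (length-map (a ,_) Nt) ⟩
  length Na + length Nt
    ≡⟨ cong₂ _+_ (reg zero a) (□-regular (G ∘ suc) (r ∘ suc) (reg ∘ suc) t) ⟩
  r zero + ∑ (r ∘ suc)                        ∎
  where
  open ≡-Reasoning
  Na = Graph.N (G zero) a
  Nt = Graph.N (□ (G ∘ suc)) t

-- The mixed radix labelling

-- `enumTuple` applied to the inverse labellings decodes a number into its digits; its inverse is
-- the mixed radix encoding.
□-labelling : ∀ {k} (G : Fin k → Graph) → (∀ i → Labelling (G i)) → Labelling (□ G)
□-labelling G f = ↔⇒⤖ (↔-sym (enumTuple (λ i → ↔-sym (⤖⇒↔ (f i)))))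

module _ {k} (G : Fin (suc k) → Graph) (f : ∀ i → Labelling (G i)) where
  private
    module G₀ = Graph (G zero)
    module G′ = Graph (□ (G ∘ suc))
    n′ = G′.order
    F  = □-labelling G f
    f₀ = f zero
    F′ = □-labelling (G ∘ suc) (f ∘ suc)

  -- The inverse of `*↔×` is `combine`, which gives the first coordinate the place value `n′`.
  label-□ : ∀ a t → label (□ G) F (a , t) ≡
            n′ * label (G zero) f₀ a + label (□ (G ∘ suc)) F′ t
  label-□ a t = toℕ-combine (Bijection.to f₀ a) (Bijection.to F′ t)

  -- The first bracket comes from the neighbours that move `a`, the second from those that move `t`.
  weight-□ : ∀ a t → weight (□ G) F (a , t) ≡
             (n′ * weight (G zero) f₀ a + length (G₀.N a) * label (□ (G ∘ suc)) F′ t) +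
             (length (G′.N t) * (n′ * label (G zero) f₀ a) + weight (□ (G ∘ suc)) F′ t)
  weight-□ a t = begin
    weight (□ G) F (a , t)
      ≡⟨ cong sum (map-cong (λ (b , s) → label-□ b s) (Graph.N (□ G) (a , t))) ⟩
    sum (map (λ (b , s) → n′ * l₀ b + l′ s) (Graph.N (□ G) (a , t)))
      ≡⟨ sum-N-□ G (λ (b , s) → n′ * l₀ b + l′ s) a t ⟩
    sum (map (λ b → n′ * l₀ b + l′ t) (G₀.N a)) + sum (map (λ s → n′ * l₀ a + l′ s) (G′.N t))
      ≡⟨ cong₂ _+_ (sum-map-*+const n′ l₀ (l′ t) (G₀.N a))
                   (sum-map-const+ l′ (n′ * l₀ a) (G′.N t)) ⟩
    (n′ * weight (G zero) f₀ a + length (G₀.N a) * l′ t) +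
    (length (G′.N t) * (n′ * l₀ a) + weight (□ (G ∘ suc)) F′ t) ∎
    where
    open ≡-Reasoning
    l₀ = label (G zero) f₀
    l′ = label (□ (G ∘ suc)) F′

-- Induction on `k`. The constant `c` accumulates the degrees of the factors already split off: a
-- neighbour along such a factor keeps the remaining coordinates, and so adds one more copy of their
-- label.
□-injective : ∀ {k} (G : Fin k → Graph) (r : Fin k → ℕ) (f : ∀ i → Labelling (G i)) →
  (∀ i → IsRegular (G i) (r i)) → (∀ i → IsBalanced (G i) (r i) (f i)) →
  let F = □-labelling G f in
  ∀ c → Coprime (c + ∑ r) (Graph.order (□ G)) → ∀ x y →
  c * label (□ G) F x + weight (□ G) F x ≡ c * label (□ G) F y + weight (□ G) F y
    [mod Graph.order (□ G) ] →
  x ≡ y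
□-injective {zero}  G r f reg bal c cop tt      tt      _  = refl
□-injective {suc k} G r f reg bal c cop (a , t) (b , s) eq =
  -- The label of `t` inhabits `Fin n′`, so `n′` is nonzero and may be cancelled.
  cong₂ _,_ (a≡b {{nonZeroIndex (Bijection.to F′ t)}} t≡s) t≡s
  where
  n₀ = Graph.order (G zero)
  n′ = Graph.order (□ (G ∘ suc))
  F  = □-labelling G f
  F′ = □-labelling (G ∘ suc) (f ∘ suc)
  r₀ = r zero
  r′ = ∑ (r ∘ suc)
  l₀ = label (G zero) (f zero)
  w₀ = weight (G zero) (f zero)
  l′ = label (□ (G ∘ suc)) F′
  w′ = weight (□ (G ∘ suc)) F′

  W : Graph.V (□ G) → ℕ
  W x = c * label (□ G) F x + weight (□ G) F x

  W′ : Graph.V (□ (G ∘ suc)) → ℕ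
  W′ t = (c + r₀) * l′ t + w′ t

  D : Graph.V (G zero) → ℕ
  D a = (c + r′) * l₀ a + w₀ a

  -- Collecting multiples of `n′`: the `r′` neighbours along the tail each repeat the digit `l₀ a`,
  -- and the `r₀` along the head each repeat `l′ t`.
  split : ∀ a t → W (a , t) ≡ n′ * D a + W′ t
  split a t
    rewrite label-□ G f a t | weight-□ G f a t | reg zero a
          | □-regular (G ∘ suc) (r ∘ suc) (reg ∘ suc) t
    = regroup c n′ r₀ r′ (l₀ a) (w₀ a) (l′ t) (w′ t)
    where
    regroup : ∀ c n r₀ r′ la wa lt wt →
      c * (n * la + lt) + ((n * wa + r₀ * lt) + (r′ * (n * la) + wt)) ≡
      n * ((c + r′) * la + wa) + ((c + r₀) * lt + wt)
    regroup = solve-∀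

  eq-split : n′ * D a + W′ t ≡ n′ * D b + W′ s [mod n₀ * n′ ]
  eq-split = subst₂ (λ u v → n₀ * n′ ∣ ∣ u - v ∣) (split a t) (split b s) eq

  coprime-tail : Coprime (c + r₀ + r′) n′
  coprime-tail {d} (d∣ , d∣n′) =
    cop (subst (d ∣_) (+-assoc c r₀ r′) d∣ , ∣n⇒∣m*n n₀ d∣n′)

  coprime-head : Coprime (c + (r₀ + r′)) n₀
  coprime-head (d∣ , d∣n₀) = cop (d∣ , ∣m⇒∣m*n n′ d∣n₀)

  t≡s : t ≡ s
  t≡s = □-injective (G ∘ suc) (r ∘ suc) (f ∘ suc) (reg ∘ suc) (bal ∘ suc)
    (c + r₀) coprime-tail t s
    -- The congruence is weakened from `n₀ * n′` to its divisor `n′`, where the terms in `D` vanish.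
    (mod-conv (n′ * D a + W′ t) (W′ t) (n′ * D b + W′ s) (W′ s)
      (n*m+a≡a n′ (D a) (W′ t)) (n*m+a≡a n′ (D b) (W′ s))
      (∣-trans (n∣m*n n₀) eq-split))

  -- Balancedness of the first factor turns `w₀ a` into `r₀ * l₀ a`; adding `(c + r′) * l₀ a` to
  -- both sides keeps their distance.
  D≡ : ∀ a → D a ≡ (c + (r₀ + r′)) * l₀ a [mod n₀ ]
  D≡ a = subst (n₀ ∣_) (begin
    ∣ w₀ a - r₀ * l₀ a ∣
      ≡⟨ ∣m+n-m+o∣≡∣n-o∣ ((c + r′) * l₀ a) (w₀ a) (r₀ * l₀ a) ⟨
    ∣ D a - (c + r′) * l₀ a + r₀ * l₀ a ∣
      ≡⟨ cong (∣ D a -_∣) (regroup c r₀ r′ (l₀ a)) ⟩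
    ∣ D a - (c + (r₀ + r′)) * l₀ a ∣ ∎) (bal zero a)
    where
    open ≡-Reasoning
    regroup : ∀ c r₀ r′ l → (c + r′) * l + r₀ * l ≡ (c + (r₀ + r′)) * l
    regroup = solve-∀

  a≡b : .{{_ : NonZero n′}} → t ≡ s → a ≡ b
  -- With `s` identified with `t`, the summand `W′ t` is common to both sides and cancels. Dividing
  -- by `n′` leaves `D a` and `D b` congruent mod `n₀`, and the coprime factor of `D≡` cancels last.
  a≡b refl = Bijection.injective (f zero) (mod-toℕ-injective _ _
    (mod-coprime-cancelˡ (c + (r₀ + r′)) (l₀ a) (l₀ b) coprime-head
      (mod-conv (D a) _ (D b) _ (D≡ a) (D≡ b)
        (mod-*-cancelˡ n′ (D a) (D b)
          (subst (_∣ ∣ n′ * D a - n′ * D b ∣) (*-comm n₀ n′)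
            (mod-+-cancelʳ (W′ t) (n′ * D a) (n′ * D b) eq-split))))))

mainTheorem12 : (k : ℕ) → 1 ≤ k →
    (G : Fin k → Graph) (r : Fin k → ℕ) →
    (∀ i → IsRegular (G i) (r i)) →
    (∀ i → ∃ λ (f : Labelling (G i)) → IsBalanced (G i) (r i) f) →
    (∀ i j → r i ≤ Graph.order (G j)) →
    Coprime (∑ r) (∏ λ i → Graph.order (G i)) →
    DistanceAntimagic (□ G)
mainTheorem12 k _ G r reg bal _ cop = □-labelling G f , λ x y x≢y eq →
  -- At `c = 0` the quantity shown injective is the weight itself.
  x≢y (□-injective G r f reg (proj₂ ∘ bal) 0 cop x y eq)
  where
  f : ∀ i → Labelling (G i)
  f = proj₁ ∘ bal
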